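{- For positive integers $b$ and $n$, the number of minimal crossing juggling card sequences with $b$ balls and $n$ cards is \[ f(n,b)=\frac1b\binom{n-1}{b-1}\binom{n}{b-1}=\frac1n\binom{n}{b}\binom{n}{b-1}, \] the Narayana numbers.
   Context: There are $b$ balls on levels $1,\dots,b$. For $1\le i\le b$ the card $C_i$ induces the permutation $\pi_{C_i}$ of $[b]$ with $\pi_{C_i}(1)=i$, $\pi_{C_i}(j)=j-1$ for $2\le j\le i$, $\pi_{C_i}(j)=j$ for $j>i$. For a juggling card sequence $A=C_{i_1}\cdots C_{i_n}$ (cards from $\{C_1,\dots,C_b\}$), $\pi_A=\pi_{C_{i_n}}\circ\cdots\circ\pi_{C_{i_1}}$ (the final level of the ball starting at level $j$ is $\pi_A(j)$), and the number of crossings is $Cr(A)=\sum_{k=1}^n(i_k-1)$. A minimal crossing juggling card sequence with $b$ balls is a juggling card sequence with cards from $\{C_1,\dots,C_b\}$ that uses the card $C_b$ at least once, has $\pi_A=\mathrm{id}$, and has $Cr(A)=b(b-1)$. -}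

module Defs where

open import Data.Nat using (ℕ; zero; suc; _+_; _*_; _∸_; _≤_; _≤?_; _≟_)
open import Data.Nat.Combinatorics using (_C_)
open import Data.Fin using (Fin; toℕ)
open import Data.List using (List; []; _∷_; map; concatMap; filter; length; upTo; allFin)
open import Data.Nat.ListAction using (sum)
open import Data.List.Relation.Unary.All using (All; all?)
open import Data.List.Relation.Unary.Any using (Any; any?)
open import Data.Product using (_×_)
open import Data.Bool using (Bool; true; false; if_then_else_)
open import Relation.Nullary using (Dec; yes; no; ¬_)
open import Relation.Nullary.Decidable using (_×-dec_; ⌊_⌋)
open import Relation.Binary.PropositionalEquality using (_≡_)

-- A card is C_i with 1 ≤ i ≤ b; we represent C_i by an element k : Fin b with i = toℕ k + 1.
Card : ℕ → Set
Card b = Fin b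

cardIndex : ∀ {b} → Card b → ℕ
cardIndex k = suc (toℕ k)

-- The permutation π_{C_i} acting on levels (levels are the naturals 1,…,b):
-- π(1) = i, π(j) = j - 1 for 2 ≤ j ≤ i, π(j) = j for j > i.
πC : ℕ → ℕ → ℕ
πC i j with j ≟ 1
... | yes _ = i
... | no _ with j ≤? i
...   | yes _ = j ∸ 1
...   | no _  = j

πSeq : ∀ {b} → List (Card b) → ℕ → ℕ
πSeq []       j = j
πSeq (c ∷ cs) j = πSeq cs (πC (cardIndex c) j)

Cr : ∀ {b} → List (Card b) → ℕ
Cr cs = sum (map toℕ cs)

levels : ℕ → List ℕ
levels b = map suc (upTo b)

IsId : ∀ {b} → List (Card b) → Set
IsId {b} cs = All (λ j → πSeq cs j ≡ j) (levels b)

UsesTop : ∀ {b} → List (Card b) → Set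
UsesTop {b} cs = Any (λ c → cardIndex c ≡ b) cs

MinimalCrossing : ∀ {b} → List (Card b) → Set
MinimalCrossing {b} cs = UsesTop cs × IsId cs × (Cr cs ≡ b * (b ∸ 1))

minimalCrossing? : ∀ {b} (cs : List (Card b)) → Dec (MinimalCrossing cs)
minimalCrossing? {b} cs =
  any? (λ c → cardIndex c ≟ b) cs
  ×-dec (all? (λ j → πSeq cs j ≟ j) (levels b)
  ×-dec (Cr cs ≟ b * (b ∸ 1)))

sequences : (b n : ℕ) → List (List (Card b))
sequences b zero    = [] ∷ []
sequences b (suc n) = concatMap (λ c → map (c ∷_) (sequences b n)) (allFin b)

f : ℕ → ℕ → ℕ
f n b = length (filter minimalCrossing? (sequences b n))

{-# OPTIONS --safe #-}
-- Read a sequence from its last card. Let T list the balls thrown in the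
-- suffix read so far, in the order of their next throws, each named by its
-- final level; the other balls U lie above them in increasing order. Prepending
-- a card moves one ball to the front. For t ∈ T below a ball u, the suffix needs
-- one crossing if t > u, and two if t < u and u ∈ T; Cr is the sum of these
-- needs plus twice the number of wasted crossings. Hence the minimal sequences
-- are those which reach T = 0, …, b − 1 with no waste.
--
-- Undoing the first throw of a waste-free T = x ∷ T′ leaves T′ (x was thrown
-- only once) or T′ with x inserted behind some of the leading entries larger
-- than x. Only the pattern of T matters for the count: which of its balls are
-- fresh (not thrown before, increasing) and which are live (thrown before,
-- decreasing and below the fresh ones). Summed over all patterns with a fresh
-- and h live balls, the count is that of 2-coloured Motzkin paths, and the
-- reflection principle evaluates it as a difference of products of binomial
-- coefficients.
module Submission where

open import Defs
open import Algebra.Properties.CommutativeSemigroup using (interchange; x∙yz≈y∙xz)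
open import Data.Empty using (⊥-elim)
open import Data.Fin using (Fin; toℕ)
open import Data.Fin.Properties using (toℕ<n)
open import Data.List using (List; []; _∷_; _++_; _∷ʳ_; allFin; applyUpTo; concatMap; filter; length; map; replicate; tabulate; take; upTo)
open import Data.List.Membership.Propositional using (_∈_; _∉_)
open import Data.List.Membership.Propositional.Properties using (∈-++⁻; ∈-upTo⁺; ∈-upTo⁻)
open import Data.List.Properties using (++-identityʳ; length-++; length-upTo; map-++; map-∘; upTo-∷ʳ; ≡-dec)
import Data.List.Relation.Binary.Permutation.Propositional as ↭
open ↭ using (_↭_)
open import Data.List.Relation.Binary.Permutation.Propositional.Properties using (↭-length; ∈-resp-↭)
import Data.List.Relation.Binary.Permutation.Setoid.Properties as Setoid↭
open import Data.List.Relation.Unary.All as All using (All; []; _∷_)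
import Data.List.Relation.Unary.All.Properties as All
open import Data.List.Relation.Unary.AllPairs using (AllPairs; []; _∷_)
import Data.List.Relation.Unary.AllPairs.Properties as AllPairs
open import Data.List.Relation.Unary.Any using (here; there)
open import Data.List.Relation.Unary.Unique.Propositional using (Unique)
import Data.List.Relation.Unary.Unique.Propositional.Properties as Unique
open import Data.Nat
open import Data.Nat.Combinatorics using (_C_; k>n⇒nCk≡0; nC1≡n; nCk+nC[k+1]≡[n+1]C[k+1]; nCk≡nC[n∸k]; nCn≡1)
open import Data.Nat.ListAction using (sum)
open import Data.Nat.ListAction.Properties using (sum-++)
open import Data.Nat.Properties
open import Data.Nat.Tactic.RingSolver using (solve-∀)
open import Data.Product using (_×_; _,_; proj₁; proj₂; ∃-syntax)
open import Data.Sum using (_⊎_; inj₁; inj₂)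
open import Relation.Binary.PropositionalEquality
open import Relation.Nullary using (Dec; yes; no; ¬_)
open ≡-Reasoning

-- Rearrangements of sums and products

+-interchange : ∀ a b c d → (a + b) + (c + d) ≡ (a + c) + (b + d)
+-interchange = interchange +-commutativeSemigroup

+-swapˡ : ∀ a b c → a + (b + c) ≡ b + (a + c)
+-swapˡ = x∙yz≈y∙xz +-commutativeSemigroup

*-swapˡ : ∀ a b c → a * (b * c) ≡ b * (a * c)
*-swapˡ = x∙yz≈y∙xz *-commutativeSemigroup

-- Counting patterns

-- For weights 0 and 1 this sums `g` over the lists in which `a` is placed behind zero or more of
-- the leading entries of weight 1. The weight is a parameter because the same shape occurs for
-- patterns (`isFresh`) and for lists of balls (`Above x`).
insertions : ∀ {A : Set} → (A → ℕ) → A → (List A → ℕ) → List A → ℕ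
insertions w a g []       = g (a ∷ [])
insertions w a g (t ∷ ts) = g (a ∷ t ∷ ts) + w t * insertions w a (λ s → g (t ∷ s)) ts

data Status : Set where
  fresh live : Status

isFresh : Status → ℕ
isFresh fresh = 1
isFresh live  = 0

-- The number of waste-free sequences of `n` cards whose thrown list has this pattern. Undoing the
-- first throw either removes its ball for good or, if the ball is thrown again, puts it back as a
-- live ball behind some of the leading fresh ones.
throws : List Status → ℕ → ℕ
throws []      zero    = 1
throws []      (suc n) = 0
throws (_ ∷ s) zero    = 0
throws (_ ∷ s) (suc n) = throws s n + insertions isFresh live (λ r → throws r n) s

interleavings : ℕ → ℕ → (List Status → ℕ) → ℕ
interleavings zero    zero    g = g []
interleavings zero    (suc h) g = interleavings zero h (λ s → g (live ∷ s))
interleavings (suc a) zero    g = interleavings a zero (λ s → g (fresh ∷ s))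
interleavings (suc a) (suc h) g =
  interleavings a (suc h) (λ s → g (fresh ∷ s)) + interleavings (suc a) h (λ s → g (live ∷ s))

interleavings-cong : ∀ a h {g g′} → (∀ s → g s ≡ g′ s) → interleavings a h g ≡ interleavings a h g′
interleavings-cong zero    zero    e = e []
interleavings-cong zero    (suc h) e = interleavings-cong zero h (λ s → e (live ∷ s))
interleavings-cong (suc a) zero    e = interleavings-cong a zero (λ s → e (fresh ∷ s))
interleavings-cong (suc a) (suc h) e =
  cong₂ _+_ (interleavings-cong a (suc h) (λ s → e (fresh ∷ s)))
            (interleavings-cong (suc a) h (λ s → e (live ∷ s)))

interleavings-+ : ∀ a h g g′ →
  interleavings a h (λ s → g s + g′ s) ≡ interleavings a h g + interleavings a h g′
interleavings-+ zero    zero    g g′ = refl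
interleavings-+ zero    (suc h) g g′ = interleavings-+ zero h _ _
interleavings-+ (suc a) zero    g g′ = interleavings-+ a zero _ _
interleavings-+ (suc a) (suc h) g g′ = trans
  (cong₂ _+_ (interleavings-+ a (suc h) _ _) (interleavings-+ (suc a) h _ _))
  (+-interchange (interleavings a (suc h) (λ s → g (fresh ∷ s))) _ _ _)

interleavings-replicate : ∀ a g → interleavings a 0 g ≡ g (replicate a fresh)
interleavings-replicate zero    g = refl
interleavings-replicate (suc a) g = interleavings-replicate a _

-- Deleting the first live ball is a bijection between interleavings with
-- h + 1 live balls and interleavings with h live balls and a marked place
-- in their initial run of fresh balls.
interleavings-insertions : ∀ a h g →
  interleavings a h (insertions isFresh live g) ≡ interleavings a (suc h) g
interleavings-insertions zero    zero    g = refl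
interleavings-insertions zero    (suc h) g = interleavings-cong zero h (λ _ → +-identityʳ _)
interleavings-insertions (suc a) zero    g = begin
  interleavings a 0 (λ r → g (live ∷ fresh ∷ r) + 1 * insertions isFresh live (λ s → g (fresh ∷ s)) r)
    ≡⟨ interleavings-cong a 0 (λ r → cong₂ _+_ refl (*-identityˡ (insertions isFresh live (λ s → g (fresh ∷ s)) r))) ⟩
  interleavings a 0 (λ r → g (live ∷ fresh ∷ r) + insertions isFresh live (λ s → g (fresh ∷ s)) r)
    ≡⟨ interleavings-+ a 0 _ _ ⟩
  interleavings a 0 (λ r → g (live ∷ fresh ∷ r)) + interleavings a 0 (insertions isFresh live (λ s → g (fresh ∷ s)))
    ≡⟨ cong₂ _+_ refl (interleavings-insertions a 0 _) ⟩
  interleavings a 0 (λ r → g (live ∷ fresh ∷ r)) + interleavings a 1 (λ s → g (fresh ∷ s))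
    ≡⟨ +-comm (interleavings a 0 (λ r → g (live ∷ fresh ∷ r))) _ ⟩
  interleavings (suc a) 1 g ∎
interleavings-insertions (suc a) (suc h) g = begin
  interleavings a (suc h) (λ r → g (live ∷ fresh ∷ r) + 1 * insertions isFresh live (λ s → g (fresh ∷ s)) r)
    + interleavings (suc a) h (λ r → g (live ∷ live ∷ r) + 0)
    ≡⟨ cong₂ _+_ (interleavings-cong a (suc h) (λ r → cong₂ _+_ refl (*-identityˡ (insertions isFresh live (λ s → g (fresh ∷ s)) r))))
                 (interleavings-cong (suc a) h (λ _ → +-identityʳ _)) ⟩
  interleavings a (suc h) (λ r → g (live ∷ fresh ∷ r) + insertions isFresh live (λ s → g (fresh ∷ s)) r)
    + interleavings (suc a) h (λ r → g (live ∷ live ∷ r))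
    ≡⟨ cong (_+ interleavings (suc a) h (λ r → g (live ∷ live ∷ r))) (interleavings-+ a (suc h) _ _) ⟩
  (interleavings a (suc h) (λ r → g (live ∷ fresh ∷ r))
    + interleavings a (suc h) (insertions isFresh live (λ s → g (fresh ∷ s))))
    + interleavings (suc a) h (λ r → g (live ∷ live ∷ r))
    ≡⟨ cong (λ z → (interleavings a (suc h) (λ r → g (live ∷ fresh ∷ r)) + z) + interleavings (suc a) h (λ r → g (live ∷ live ∷ r)))
            (interleavings-insertions a (suc h) _) ⟩
  (interleavings a (suc h) (λ r → g (live ∷ fresh ∷ r)) + interleavings a (suc (suc h)) (λ s → g (fresh ∷ s)))
    + interleavings (suc a) h (λ r → g (live ∷ live ∷ r))
    ≡⟨ rotate (interleavings a (suc h) (λ r → g (live ∷ fresh ∷ r))) _ _ ⟩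
  interleavings (suc a) (suc (suc h)) g ∎
  where
  rotate : ∀ x y z → (x + y) + z ≡ y + (x + z)
  rotate = solve-∀

-- In the recurrences below `a` drops by one exactly when the first ball is fresh, and `a + h` drops
-- by one exactly when the first ball is removed for good. So this counts pairs of lattice paths
-- with `a` and `a + h` up steps, confined by the rule that a live first ball requires a positive
-- height `h`.
total : ℕ → ℕ → ℕ → ℕ
total n a h = interleavings a h (λ s → throws s n)

advance : ∀ n a h →
  interleavings a h (λ s → throws s n + insertions isFresh live (λ r → throws r n) s)
    ≡ total n a h + total n a (suc h)
advance n a h = trans (interleavings-+ a h _ _) (cong₂ _+_ refl (interleavings-insertions a h _))

pascal : ∀ n k → suc n C suc k ≡ n C k + n C suc k
pascal n k = sym (nCk+nC[k+1]≡[n+1]C[k+1] n k)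

nC0≡1 : ∀ n → n C 0 ≡ 1
nC0≡1 n = trans (nCk≡nC[n∸k] {0} {n} z≤n) (nCn≡1 n)

total-fresh : ∀ n a → total (suc n) (suc a) 0 ≡ total n a 0 + total n a 1
total-fresh n a = advance n a 0

total-live : ∀ n h → total (suc n) 0 (suc h) ≡ total n 0 h + total n 0 (suc h)
total-live n h = advance n 0 h

total-both : ∀ n a h → total (suc n) (suc a) (suc h) ≡
  (total n a (suc h) + total n a (suc (suc h))) + (total n (suc a) h + total n (suc a) (suc h))
total-both n a h = cong₂ _+_ (advance n a (suc h)) (advance n (suc a) h)

interleavings-0 : ∀ a h → interleavings a h (λ _ → 0) ≡ 0
interleavings-0 zero    zero    = refl
interleavings-0 zero    (suc h) = interleavings-0 zero h
interleavings-0 (suc a) zero    = interleavings-0 a zero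
interleavings-0 (suc a) (suc h) = cong₂ _+_ (interleavings-0 a (suc h)) (interleavings-0 (suc a) h)

total-zero : ∀ a h → 1 ≤ a + h → total 0 a h ≡ 0
total-zero zero    (suc h) _ = interleavings-0 zero h
total-zero (suc a) zero    _ = interleavings-0 a zero
total-zero (suc a) (suc h) _ = cong₂ _+_ (interleavings-0 a (suc h)) (interleavings-0 (suc a) h)

-- The reflection principle for pairs of lattice paths, with the subtracted
-- term moved to the left; the number of cards is shifted because the formula
-- fails for zero cards.
total-closed : ∀ n a h →
  total (suc n) a h + (suc (suc n) C a) * (n C (a + h)) ≡ (suc n C a) * (suc n C (a + h))
total-closed zero zero          zero          = refl
total-closed zero zero          (suc zero)    = refl
total-closed zero zero          (suc (suc h)) = cong (_+ 0) (total-zero 0 (suc (suc h)) (s≤s z≤n))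
total-closed zero (suc zero)    zero          = refl
total-closed zero (suc (suc a)) zero          = cong₂ _+_
  (trans (total-fresh 0 (suc a))
    (cong₂ _+_ (total-zero (suc a) 0 (s≤s z≤n)) (total-zero (suc a) 1 (s≤s z≤n))))
  (*-zeroʳ (2 C (2 + a)))
total-closed zero (suc a)       (suc h)       rewrite +-suc a h = trans
  (cong₂ _+_
    (trans (total-both 0 a h) (cong₂ _+_
      (cong₂ _+_ (total-zero a (suc h) (≤-trans (s≤s z≤n) (m≤n+m (suc h) a))) (total-zero a (2 + h) (≤-trans (s≤s z≤n) (m≤n+m (2 + h) a))))
      (cong₂ _+_ (total-zero (suc a) h (s≤s z≤n)) (total-zero (suc a) (suc h) (s≤s z≤n)))))
    (*-zeroʳ (2 C suc a)))
  (sym (*-zeroʳ (1 C suc a)))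
total-closed (suc n) zero zero = cong₂ _*_
  (trans (nC0≡1 (3 + n)) (sym (nC0≡1 (2 + n))))
  (trans (nC0≡1 (1 + n)) (sym (nC0≡1 (2 + n))))
total-closed (suc n) zero (suc h) = begin
  total (suc (suc n)) 0 (suc h) + (suc (suc (suc n)) C 0) * (suc n C suc h)
    ≡⟨ cong₂ _+_ (total-live (suc n) h)
         (cong₂ _*_ (trans (nC0≡1 (3 + n)) (sym (nC0≡1 (2 + n)))) (pascal n h)) ⟩
  (x + y) + u * (c + d)
    ≡⟨ regroup x y u c d ⟩
  (x + u * c) + (y + u * d)
    ≡⟨ cong₂ _+_ (total-closed n 0 h) (total-closed n 0 (suc h)) ⟩
  p * q + p * r
    ≡⟨ sym (*-distribˡ-+ p q r) ⟩
  p * (q + r)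
    ≡⟨ cong₂ _*_ (trans (nC0≡1 (1 + n)) (sym (nC0≡1 (2 + n)))) (sym (pascal (suc n) h)) ⟩
  (suc (suc n) C 0) * (suc (suc n) C suc h) ∎
  where
  x = total (suc n) 0 h
  y = total (suc n) 0 (suc h)
  u = suc (suc n) C 0
  c = n C h
  d = n C suc h
  p = suc n C 0
  q = suc n C h
  r = suc n C suc h
  regroup : ∀ x y u c d → (x + y) + u * (c + d) ≡ (x + u * c) + (y + u * d)
  regroup = solve-∀
-- At height 0 the two terms with a live first ball are absent. The reflected term compensates:
-- beyond its shares `u * c` and `u * d` it contains `(p + q) * q`, which is what those terms would
-- have added.
total-closed (suc n) (suc a) zero rewrite +-identityʳ a = begin
  total (suc (suc n)) (suc a) 0 + (suc (suc (suc n)) C suc a) * (suc n C suc a)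
    ≡⟨ cong₂ _+_ (total-fresh (suc n) a)
         (cong (_* q) (trans (pascal (suc (suc n)) a) (cong (u +_) (pascal (suc n) a)))) ⟩
  (x + y) + (u + (p + q)) * q
    ≡⟨ cong (λ z → (x + y) + (u + (p + z)) * z) (pascal n a) ⟩
  (x + y) + (u + (p + (c + d))) * (c + d)
    ≡⟨ regroup x y u p c d ⟩
  ((x + u * c) + (y + u * d)) + (p + (c + d)) * (c + d)
    ≡⟨ cong (_+ (p + (c + d)) * (c + d)) (cong₂ _+_ ih₀ ih₁) ⟩
  (p * p + p * q) + (p + (c + d)) * (c + d)
    ≡⟨ cong (λ z → (p * p + p * q) + (p + z) * z) (sym (pascal n a)) ⟩
  (p * p + p * q) + (p + q) * q
    ≡⟨ square p q ⟩
  (p + q) * (p + q)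
    ≡⟨ sym (cong₂ _*_ (pascal (suc n) a) (pascal (suc n) a)) ⟩
  (suc (suc n) C suc a) * (suc (suc n) C suc a) ∎
  where
  x = total (suc n) a 0
  y = total (suc n) a 1
  u = suc (suc n) C a
  c = n C a
  d = n C suc a
  p = suc n C a
  q = suc n C suc a
  ih₀ : x + u * c ≡ p * p
  ih₀ = subst (λ k → x + u * (n C k) ≡ p * (suc n C k)) (+-identityʳ a) (total-closed n a 0)
  ih₁ : y + u * d ≡ p * q
  ih₁ = subst (λ k → y + u * (n C k) ≡ p * (suc n C k)) (+-comm a 1) (total-closed n a 1)
  regroup : ∀ x y u p c d → (x + y) + (u + (p + (c + d))) * (c + d)
    ≡ ((x + u * c) + (y + u * d)) + (p + (c + d)) * (c + d)
  regroup = solve-∀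
  square : ∀ p q → (p * p + p * q) + (p + q) * q ≡ (p + q) * (p + q)
  square = solve-∀
total-closed (suc n) (suc a) (suc h) rewrite +-suc a h = begin
  total (suc (suc n)) (suc a) (suc h) + (suc (suc (suc n)) C suc a) * (suc n C suc (suc k))
    ≡⟨ cong₂ _+_ (total-both (suc n) a h) (cong₂ _*_ (pascal (suc (suc n)) a) (pascal n (suc k))) ⟩
  ((x₁ + x₂) + (x₃ + x₄)) + (u + v) * (c + d)
    ≡⟨ regroup x₁ x₂ x₃ x₄ u v c d ⟩
  ((x₁ + u * c) + (x₂ + u * d)) + ((x₃ + v * c) + (x₄ + v * d))
    ≡⟨ cong₂ _+_ (cong₂ _+_ ih₁ ih₂) (cong₂ _+_ ih₃ ih₄) ⟩
  (p * r + p * s) + (q * r + q * s)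
    ≡⟨ factor p q r s ⟩
  (p + q) * (r + s)
    ≡⟨ sym (cong₂ _*_ (pascal (suc n) a) (pascal (suc n) (suc k))) ⟩
  (suc (suc n) C suc a) * (suc (suc n) C suc (suc k)) ∎
  where
  k = a + h
  x₁ = total (suc n) a (suc h)
  x₂ = total (suc n) a (suc (suc h))
  x₃ = total (suc n) (suc a) h
  x₄ = total (suc n) (suc a) (suc h)
  u = suc (suc n) C a
  v = suc (suc n) C suc a
  c = n C suc k
  d = n C suc (suc k)
  p = suc n C a
  q = suc n C suc a
  r = suc n C suc k
  s = suc n C suc (suc k)
  ih₁ : x₁ + u * c ≡ p * r
  ih₁ = subst (λ k → x₁ + u * (n C k) ≡ p * (suc n C k)) (+-suc a h) (total-closed n a (suc h))
  ih₂ : x₂ + u * d ≡ p * s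
  ih₂ = subst (λ k → x₂ + u * (n C k) ≡ p * (suc n C k))
          (trans (+-suc a (suc h)) (cong suc (+-suc a h))) (total-closed n a (suc (suc h)))
  ih₃ : x₃ + v * c ≡ q * r
  ih₃ = total-closed n (suc a) h
  ih₄ : x₄ + v * d ≡ q * s
  ih₄ = subst (λ k → x₄ + v * (n C suc k) ≡ q * (suc n C suc k)) (+-suc a h) (total-closed n (suc a) (suc h))
  regroup : ∀ x₁ x₂ x₃ x₄ u v c d → ((x₁ + x₂) + (x₃ + x₄)) + (u + v) * (c + d)
    ≡ ((x₁ + u * c) + (x₂ + u * d)) + ((x₃ + v * c) + (x₄ + v * d))
  regroup = solve-∀
  factor : ∀ p q r s → (p * r + p * s) + (q * r + q * s) ≡ (p + q) * (r + s)
  factor = solve-∀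

-- Binomial identities and the Narayana formulas

absorption : ∀ n k → suc k * (suc n C suc k) ≡ suc n * (n C k)
absorption n       zero    = trans (*-identityˡ _) (trans (nC1≡n (suc n)) (sym (trans (cong (suc n *_) (nC0≡1 n)) (*-identityʳ _))))
absorption zero    (suc k) = trans (cong (suc (suc k) *_) (k>n⇒nCk≡0 {1} {suc (suc k)} (s≤s (s≤s z≤n)))) (*-zeroʳ (suc (suc k)))
absorption (suc n) (suc k) = begin
  suc (suc k) * (suc (suc n) C suc (suc k))
    ≡⟨ cong (suc (suc k) *_) (pascal (suc n) (suc k)) ⟩
  suc (suc k) * (x + y)
    ≡⟨ split (suc k) x y ⟩
  x + suc k * x + suc (suc k) * y
    ≡⟨ cong₂ (λ u v → x + u + v) (absorption n k) (absorption n (suc k)) ⟩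
  x + suc n * (n C k) + suc n * (n C suc k)
    ≡⟨ trans (+-assoc x _ _) (cong (x +_) (sym (*-distribˡ-+ (suc n) (n C k) (n C suc k)))) ⟩
  x + suc n * (n C k + n C suc k)
    ≡⟨ cong (λ z → x + suc n * z) (sym (pascal n k)) ⟩
  suc (suc n) * x ∎
  where
  x = suc n C suc k
  y = suc n C suc (suc k)
  split : ∀ k x y → suc k * (x + y) ≡ x + k * x + suc k * y
  split = solve-∀

-- Follows from Pascal's rule and `absorption` by cancelling `suc k` copies of the binomial
-- coefficient; the upper index is written `k + d` to avoid truncated subtraction.
lowering : ∀ k d → suc k * ((k + d) C suc k) ≡ d * ((k + d) C k)
lowering k d = +-cancelˡ-≡ (suc k * p) _ _ (begin
  suc k * p + suc k * q       ≡⟨ sym (*-distribˡ-+ (suc k) p q) ⟩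
  suc k * (p + q)             ≡⟨ cong (suc k *_) (sym (pascal (k + d) k)) ⟩
  suc k * (suc (k + d) C suc k) ≡⟨ absorption (k + d) k ⟩
  suc (k + d) * p             ≡⟨ *-distribʳ-+ p (suc k) d ⟩
  suc k * p + d * p           ∎)
  where
  p = (k + d) C k
  q = (k + d) C suc k

-- Pascal's rule exposes `(p + q) * q` on both sides; cancelling it leaves `reduced`. After
-- multiplication by `suc a`, `lowering` turns the products into multiples of `r * p` whose
-- difference is `p * r`. The second formula follows from the first by `absorption` and cancellation
-- of `suc a`.
narayana : ∀ n a t → t + (suc (suc n) C suc a) * (n C suc a) ≡ (suc n C suc a) * (suc n C suc a) →
  (suc a * t ≡ (n C a) * (suc n C a)) × (suc n * t ≡ (suc n C suc a) * (suc n C a))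
narayana n a t e = first , *-cancelˡ-≡ _ _ (suc a) (begin
  suc a * (suc n * t)       ≡⟨ *-swapˡ (suc a) (suc n) t ⟩
  suc n * (suc a * t)       ≡⟨ cong (suc n *_) first ⟩
  suc n * (p * r)           ≡⟨ sym (*-assoc (suc n) p r) ⟩
  suc n * p * r             ≡⟨ cong (_* r) (sym (absorption n a)) ⟩
  suc a * (suc n C suc a) * r ≡⟨ *-assoc (suc a) (suc n C suc a) r ⟩
  suc a * ((suc n C suc a) * r) ∎)
  where
  p = n C a
  q = n C suc a
  r = suc n C a
  expand : ∀ t r p q → (t + r * q) + (p + q) * q ≡ t + (r + (p + q)) * q
  expand = solve-∀
  square : ∀ p q → (p + q) * (p + q) ≡ (p + q) * p + (p + q) * q
  square = solve-∀
  reduced : t + r * q ≡ (p + q) * p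
  reduced = +-cancelʳ-≡ ((p + q) * q) _ _ (begin
    (t + r * q) + (p + q) * q     ≡⟨ expand t r p q ⟩
    t + (r + (p + q)) * q         ≡⟨ cong (λ z → t + (r + z) * q) (sym (pascal n a)) ⟩
    t + (r + (suc n C suc a)) * q ≡⟨ cong (λ z → t + z * q) (sym (pascal (suc n) a)) ⟩
    t + (suc (suc n) C suc a) * q ≡⟨ e ⟩
    (suc n C suc a) * (suc n C suc a) ≡⟨ cong (λ z → z * z) (pascal n a) ⟩
    (p + q) * (p + q)             ≡⟨ square p q ⟩
    (p + q) * p + (p + q) * q     ∎)
  first : suc a * t ≡ p * r
  first with a ≤? n
  -- Here `n ∸ a` would be truncated, but `p` vanishes and both sides are 0.
  ... | no a≰n = begin
    suc a * t ≡⟨ cong (suc a *_) (m+n≡0⇒m≡0 t (trans reduced (trans (cong ((p + q) *_) p≡0) (*-zeroʳ (p + q))))) ⟩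
    suc a * 0 ≡⟨ *-zeroʳ (suc a) ⟩
    0         ≡⟨ cong (_* r) (sym p≡0) ⟩
    p * r     ∎
    where
    p≡0 : p ≡ 0
    p≡0 = k>n⇒nCk≡0 (≰⇒> a≰n)
  -- The sides are compared after adding `r * (d * p)`, which is `suc a * (r * q)` by `low`.
  ... | yes a≤n = +-cancelʳ-≡ (r * (d * p)) _ _ (begin
    suc a * t + r * (d * p)      ≡⟨ cong (λ z → suc a * t + r * z) (sym low) ⟩
    suc a * t + r * (suc a * q)  ≡⟨ factor (suc a) t r q ⟩
    suc a * (t + r * q)          ≡⟨ cong (suc a *_) reduced ⟩
    suc a * ((p + q) * p)        ≡⟨ sym (*-assoc (suc a) (p + q) p) ⟩
    suc a * (p + q) * p          ≡⟨ cong (_* p) (trans (cong (suc a *_) (sym (pascal n a))) low′) ⟩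
    suc d * r * p                ≡⟨ unfactor d r p ⟩
    p * r + r * (d * p)          ∎)
    where
    d = n ∸ a
    low : suc a * q ≡ d * p
    low = subst (λ m → suc a * (m C suc a) ≡ d * (m C a)) (m+[n∸m]≡n a≤n) (lowering a d)
    low′ : suc a * (suc n C suc a) ≡ suc d * r
    low′ = subst (λ m → suc a * (m C suc a) ≡ suc d * (m C a))
             (trans (+-suc a d) (cong suc (m+[n∸m]≡n a≤n))) (lowering a (suc d))
    factor : ∀ a t r q → a * t + r * (a * q) ≡ a * (t + r * q)
    factor = solve-∀
    unfactor : ∀ d r p → suc d * r * p ≡ p * r + r * (d * p)
    unfactor = solve-∀

-- Counting cards

indicator : ∀ {p} {P : Set p} → Dec P → ℕ
indicator (yes _) = 1
indicator (no _)  = 0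

sumBelow : ℕ → (ℕ → ℕ) → ℕ
sumBelow zero    h = 0
sumBelow (suc n) h = h 0 + sumBelow n (λ k → h (suc k))

sumBelow-cong : ∀ n {g h} → (∀ k → k < n → g k ≡ h k) → sumBelow n g ≡ sumBelow n h
sumBelow-cong zero    e = refl
sumBelow-cong (suc n) e = cong₂ _+_ (e 0 z<s) (sumBelow-cong n (λ k k<n → e (suc k) (s<s k<n)))

sumBelow-+ : ∀ m n h → sumBelow (m + n) h ≡ sumBelow m h + sumBelow n (λ k → h (m + k))
sumBelow-+ zero    n h = refl
sumBelow-+ (suc m) n h = trans (cong (h 0 +_) (sumBelow-+ m n _)) (sym (+-assoc (h 0) _ _))

sumBelow-* : ∀ n c h → sumBelow n (λ k → c * h k) ≡ c * sumBelow n h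
sumBelow-* zero    c h = sym (*-zeroʳ c)
sumBelow-* (suc n) c h = trans (cong (c * h 0 +_) (sumBelow-* n c _)) (sym (*-distribˡ-+ c (h 0) _))

insertions-* : ∀ {A : Set} (w : A → ℕ) a c g ts →
  insertions w a (λ s → c * g s) ts ≡ c * insertions w a g ts
insertions-* w a c g []       = refl
insertions-* w a c g (t ∷ ts) = begin
  c * g (a ∷ t ∷ ts) + w t * insertions w a (λ s → c * g (t ∷ s)) ts
    ≡⟨ cong (λ z → c * g (a ∷ t ∷ ts) + w t * z) (insertions-* w a c (λ s → g (t ∷ s)) ts) ⟩
  c * g (a ∷ t ∷ ts) + w t * (c * insertions w a (λ s → g (t ∷ s)) ts)
    ≡⟨ factor c (w t) (g (a ∷ t ∷ ts)) _ ⟩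
  c * insertions w a g (t ∷ ts) ∎
  where
  factor : ∀ c w x y → c * x + w * (c * y) ≡ c * (x + w * y)
  factor = solve-∀

same : List ℕ → List ℕ → ℕ
same []       []       = 1
same []       (_ ∷ _)  = 0
same (_ ∷ _)  []       = 0
same (x ∷ xs) (y ∷ ys) = indicator (x ≟ y) * same xs ys

-- The value for an index beyond the end is junk.
nth : ℕ → List ℕ → ℕ
nth k       []       = 0
nth zero    (x ∷ xs) = x
nth (suc k) (x ∷ xs) = nth k xs

delete : ℕ → List ℕ → List ℕ
delete k       []       = []
delete zero    (x ∷ xs) = xs
delete (suc k) (x ∷ xs) = x ∷ delete k xs

-- The comparison is not strict, so that the value 0 means that every entry exceeds `x`, which is
-- the condition expressed by the weight `Above x`.
atMost : ℕ → List ℕ → ℕ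
atMost x []       = 0
atMost x (y ∷ ys) = indicator (y ≤? x) + atMost x ys

isZero : ℕ → ℕ
isZero zero    = 1
isZero (suc _) = 0

isZero-+ : ∀ m n → isZero (m + n) ≡ isZero m * isZero n
isZero-+ zero    n = sym (+-identityʳ _)
isZero-+ (suc m) n = refl

indicator-≤-< : ∀ t x → isZero (indicator (t ≤? x)) ≡ indicator (x <? t)
indicator-≤-< t x with t ≤? x | x <? t
... | yes t≤x | yes x<t = ⊥-elim (≤⇒≯ t≤x x<t)
... | yes _   | no _    = refl
... | no _    | yes _   = refl
... | no t≰x  | no x≮t  = ⊥-elim (x≮t (≰⇒> t≰x))

Above : ℕ → ℕ → ℕ
Above x t = indicator (x <? t)

-- Where the indicators do not vanish, `y` is `x` and `t` is `t′`, so the test of `t` against `y`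
-- becomes the weight of `t′`.
rethrow-term : ∀ x y t t′ s a →
  indicator (y ≟ x) * (indicator (t ≟ t′) * s) * isZero (indicator (t ≤? y) + a)
  ≡ Above x t′ * (indicator (t ≟ t′) * (indicator (y ≟ x) * s * isZero a))
rethrow-term x y t t′ s a with y ≟ x | t ≟ t′
... | no _     | no _     = sym (*-zeroʳ (Above x t′))
... | no _     | yes _    = sym (*-zeroʳ (Above x t′))
... | yes _    | no _     = sym (*-zeroʳ (Above x t′))
... | yes refl | yes refl = begin
  1 * (1 * s) * isZero (indicator (t ≤? x) + a)
    ≡⟨ cong (1 * (1 * s) *_) (trans (isZero-+ (indicator (t ≤? x)) a) (cong (_* isZero a) (indicator-≤-< t x))) ⟩
  1 * (1 * s) * (Above x t * isZero a)
    ≡⟨ rearrange s (Above x t) (isZero a) ⟩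
  Above x t * (1 * (1 * s * isZero a)) ∎
  where
  rearrange : ∀ s w z → 1 * (1 * s) * (w * z) ≡ w * (1 * (1 * s * z))
  rearrange = solve-∀

-- Moving the `k`-th entry of `ts` to the front gives `x ∷ ts′` exactly when `ts` is `ts′` with `x`
-- inserted at place `k`. The move is waste-free exactly when all entries in front of that place
-- exceed `x`.
rethrow-count : ∀ x ts ts′ →
  sumBelow (length ts) (λ k → same (nth k ts ∷ delete k ts) (x ∷ ts′) * isZero (atMost (nth k ts) (take k ts)))
  ≡ insertions (Above x) x (same ts) ts′
rethrow-count x []       []         = refl
rethrow-count x []       (t′ ∷ ts′) = sym (trans (cong (Above x t′ *_) (insertions-* (Above x) x 0 (λ _ → 0) ts′)) (*-zeroʳ (Above x t′)))
rethrow-count x (t ∷ ts) []         = begin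
  indicator (t ≟ x) * same ts [] * 1 + sumBelow (length ts) _
    ≡⟨ cong₂ _+_ (*-identityʳ (indicator (t ≟ x) * same ts []))
         (trans (sumBelow-cong (length ts) (λ k _ → cong (_* isZero (atMost (nth k ts) (t ∷ take k ts))) (*-zeroʳ (indicator (nth k ts ≟ x)))))
                (sumBelow-* (length ts) 0 (λ _ → 0))) ⟩
  indicator (t ≟ x) * same ts [] + 0
    ≡⟨ +-identityʳ _ ⟩
  indicator (t ≟ x) * same ts [] ∎
rethrow-count x (t ∷ ts) (t′ ∷ ts′) = cong₂ _+_ (*-identityʳ (indicator (t ≟ x) * same ts (t′ ∷ ts′))) (begin
  sumBelow (length ts) _
    ≡⟨ sumBelow-cong (length ts) (λ k _ → rethrow-term x (nth k ts) t t′ (same (delete k ts) ts′) (atMost (nth k ts) (take k ts))) ⟩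
  sumBelow (length ts) (λ k → Above x t′ * (indicator (t ≟ t′) * term k))
    ≡⟨ trans (sumBelow-* (length ts) (Above x t′) _) (cong (Above x t′ *_) (sumBelow-* (length ts) (indicator (t ≟ t′)) term)) ⟩
  Above x t′ * (indicator (t ≟ t′) * sumBelow (length ts) term)
    ≡⟨ cong (λ z → Above x t′ * (indicator (t ≟ t′) * z)) (rethrow-count x ts ts′) ⟩
  Above x t′ * (indicator (t ≟ t′) * insertions (Above x) x (same ts) ts′)
    ≡⟨ cong (Above x t′ *_) (sym (insertions-* (Above x) x (indicator (t ≟ t′)) (same ts) ts′)) ⟩
  Above x t′ * insertions (Above x) x (λ s → indicator (t ≟ t′) * same ts s) ts′ ∎)
  where
  term : ℕ → ℕ
  term k = same (nth k ts ∷ delete k ts) (x ∷ ts′) * isZero (atMost (nth k ts) (take k ts))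

occurs-0 : ∀ {x us} → x ∉ us → sumBelow (length us) (λ k → indicator (nth k us ≟ x)) ≡ 0
occurs-0 {x} {[]}     x∉ = refl
occurs-0 {x} {u ∷ us} x∉ with u ≟ x
... | yes refl = ⊥-elim (x∉ (here refl))
... | no _     = occurs-0 (λ x∈ → x∉ (there x∈))

occurs-1 : ∀ {x us} → Unique us → x ∈ us → sumBelow (length us) (λ k → indicator (nth k us ≟ x)) ≡ 1
occurs-1 {x} {u ∷ us} (u∉ ∷ uniq) x∈ with u ≟ x | x∈
... | yes refl | _         = cong suc (occurs-0 (λ u∈ → All.lookup u∉ u∈ refl))
... | no u≢x   | here refl = ⊥-elim (u≢x refl)
... | no _     | there x∈′ = occurs-1 uniq x∈′

-- States and crossings

-- The thrown balls, then the unthrown ones. Together they list, by starting level, the final level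
-- of each ball. Prepending the card of index `k + 1` sends level 1 to level `k + 1`, hence moves
-- the `k`-th entry to the front.
State : Set
State = List ℕ × List ℕ

arrangement : State → List ℕ
arrangement (ts , us) = ts ++ us

step : ℕ → State → State
step k (ts , us) with k <? length ts
... | yes _ = nth k ts ∷ delete k ts , us
... | no _  = nth (k ∸ length ts) us ∷ ts , delete (k ∸ length ts) us

-- If `x` is thrown over a thrown ball `t > x`, the need of the pair rises from 1 to 2, in step with
-- the crossing made. If `t < x` it falls from 2 to 1, a loss of two, and such `t` are counted here.
-- A first throw raises the need of every pair it crosses by one.
excess : ℕ → State → ℕ
excess k (ts , us) with k <? length ts
... | yes _ = atMost (nth k ts) (take k ts)
... | no _  = 0

state : ∀ {b} → List (Card b) → State
state {b} []       = [] , upTo b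
state     (c ∷ cs) = step (toℕ c) (state cs)

thrown : ∀ {b} → List (Card b) → List ℕ
thrown cs = proj₁ (state cs)

unthrown : ∀ {b} → List (Card b) → List ℕ
unthrown cs = proj₂ (state cs)

waste : ∀ {b} → List (Card b) → ℕ
waste []       = 0
waste (c ∷ cs) = waste cs + excess (toℕ c) (state cs)

nth-++ˡ : ∀ k ts us → k < length ts → nth k (ts ++ us) ≡ nth k ts
nth-++ˡ zero    (t ∷ ts) us _         = refl
nth-++ˡ (suc k) (t ∷ ts) us (s≤s k<n) = nth-++ˡ k ts us k<n

nth-++ʳ : ∀ k ts us → length ts ≤ k → nth k (ts ++ us) ≡ nth (k ∸ length ts) us
nth-++ʳ k       []       us _         = refl
nth-++ʳ (suc k) (t ∷ ts) us (s≤s n≤k) = nth-++ʳ k ts us n≤k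

delete-++ˡ : ∀ k ts us → k < length ts → delete k (ts ++ us) ≡ delete k ts ++ us
delete-++ˡ zero    (t ∷ ts) us _         = refl
delete-++ˡ (suc k) (t ∷ ts) us (s≤s k<n) = cong (t ∷_) (delete-++ˡ k ts us k<n)

delete-++ʳ : ∀ k ts us → length ts ≤ k → delete k (ts ++ us) ≡ ts ++ delete (k ∸ length ts) us
delete-++ʳ k       []       us _         = refl
delete-++ʳ (suc k) (t ∷ ts) us (s≤s n≤k) = cong (t ∷_) (delete-++ʳ k ts us n≤k)

arrangement-step : ∀ k st → arrangement (step k st) ≡ nth k (arrangement st) ∷ delete k (arrangement st)
arrangement-step k (ts , us) with k <? length ts
... | yes k<n = sym (cong₂ _∷_ (nth-++ˡ k ts us k<n) (delete-++ˡ k ts us k<n))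
... | no k≮n  = sym (cong₂ _∷_ (nth-++ʳ k ts us (≮⇒≥ k≮n)) (delete-++ʳ k ts us (≮⇒≥ k≮n)))

nth-delete-↭ : ∀ k xs → k < length xs → nth k xs ∷ delete k xs ↭ xs
nth-delete-↭ zero    (x ∷ xs) _         = ↭.↭-refl
nth-delete-↭ (suc k) (x ∷ xs) (s≤s k<n) = ↭.trans (↭.swap _ x ↭.↭-refl) (↭.prep x (nth-delete-↭ k xs k<n))

arrangement-↭ : ∀ {b} (cs : List (Card b)) → arrangement (state cs) ↭ upTo b
arrangement-length : ∀ {b} (cs : List (Card b)) → length (arrangement (state cs)) ≡ b

arrangement-↭ []       = ↭.↭-refl
arrangement-↭ (c ∷ cs) = ↭.↭-trans (↭.↭-reflexive (arrangement-step (toℕ c) (state cs)))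
  (↭.↭-trans (nth-delete-↭ (toℕ c) _ (subst (toℕ c <_) (sym (arrangement-length cs)) (toℕ<n c))) (arrangement-↭ cs))
arrangement-length {b} cs = trans (↭-length (arrangement-↭ cs)) (length-upTo b)

arrangement-unique : ∀ {b} (cs : List (Card b)) → Unique (arrangement (state cs))
arrangement-unique {b} cs = Setoid↭.Unique-resp-↭ (setoid ℕ) (↭.↭⇒↭ₛ (↭.↭-sym (arrangement-↭ cs))) (Unique.upTo⁺ b)

delete-All : ∀ {P : ℕ → Set} k {xs} → All P xs → All P (delete k xs)
delete-All k       []       = []
delete-All zero    (p ∷ ps) = ps
delete-All (suc k) (p ∷ ps) = p ∷ delete-All k ps

delete-AllPairs : ∀ {R : ℕ → ℕ → Set} k {xs} → AllPairs R xs → AllPairs R (delete k xs)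
delete-AllPairs k       []       = []
delete-AllPairs zero    (p ∷ ps) = ps
delete-AllPairs (suc k) (p ∷ ps) = delete-All k p ∷ delete-AllPairs k ps

step-sorted : ∀ k st → AllPairs _<_ (proj₂ st) → AllPairs _<_ (proj₂ (step k st))
step-sorted k (ts , us) sorted with k <? length ts
... | yes _ = sorted
... | no _  = delete-AllPairs (k ∸ length ts) sorted

unthrown-sorted : ∀ {b} (cs : List (Card b)) → AllPairs _<_ (unthrown cs)
unthrown-sorted {b} []       = AllPairs.applyUpTo⁺₁ (λ i → i) b (λ i<j _ → i<j)
unthrown-sorted     (c ∷ cs) = step-sorted (toℕ c) (state cs) (unthrown-sorted cs)

-- Needed crossings as a potential

above below : ℕ → List ℕ → ℕ
above x []       = 0
above x (y ∷ ys) = indicator (x <? y) + above x ys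
below x []       = 0
below x (y ∷ ys) = indicator (y <? x) + below x ys

-- The needs of the pairs of thrown balls: one crossing for each pair and a second one if the pair
-- is increasing.
returns : List ℕ → ℕ
returns []       = 0
returns (t ∷ ts) = length ts + above t ts + returns ts

overtaken : List ℕ → List ℕ → ℕ
overtaken []       us = 0
overtaken (t ∷ ts) us = below t us + overtaken ts us

potential : State → ℕ
potential (ts , us) = returns ts + overtaken ts us

length-delete : ∀ k xs → k < length xs → suc (length (delete k xs)) ≡ length xs
length-delete zero    (x ∷ xs) _         = refl
length-delete (suc k) (x ∷ xs) (s≤s k<n) = cong suc (length-delete k xs k<n)

above-delete : ∀ x k ys → k < length ys → above x ys ≡ indicator (x <? nth k ys) + above x (delete k ys)
above-delete x zero    (y ∷ ys) _         = refl
above-delete x (suc k) (y ∷ ys) (s≤s k<n) =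
  trans (cong (indicator (x <? y) +_) (above-delete x k ys k<n)) (+-swapˡ (indicator (x <? y)) (indicator (x <? nth k ys)) (above x (delete k ys)))

below-delete : ∀ x k ys → k < length ys → below x ys ≡ indicator (nth k ys <? x) + below x (delete k ys)
below-delete x zero    (y ∷ ys) _         = refl
below-delete x (suc k) (y ∷ ys) (s≤s k<n) =
  trans (cong (indicator (y <? x) +_) (below-delete x k ys k<n)) (+-swapˡ (indicator (y <? x)) (indicator (nth k ys <? x)) (below x (delete k ys)))

overtaken-rethrow : ∀ k ts us → k < length ts → overtaken (nth k ts ∷ delete k ts) us ≡ overtaken ts us
overtaken-rethrow zero    (t ∷ ts) us _         = refl
overtaken-rethrow (suc k) (t ∷ ts) us (s≤s k<n) =
  trans (+-swapˡ (below (nth k ts) us) (below t us) (overtaken (delete k ts) us)) (cong (below t us +_) (overtaken-rethrow k ts us k<n))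

overtaken-delete : ∀ k ts us → k < length us → overtaken ts us ≡ above (nth k us) ts + overtaken ts (delete k us)
overtaken-delete k []       us _   = refl
overtaken-delete k (t ∷ ts) us k<n =
  trans (cong₂ _+_ (below-delete t k us k<n) (overtaken-delete k ts us k<n))
          (+-interchange (indicator (nth k us <? t)) _ _ _)

below-All : ∀ {x ys} → All (x <_) ys → below x ys ≡ 0
below-All []                         = refl
below-All {x} {y ∷ ys} (x<y ∷ x<ys) with y <? x
... | yes y<x = ⊥-elim (<-asym x<y y<x)
... | no _    = below-All x<ys

nth-All : ∀ {P : ℕ → Set} k {xs} → k < length xs → All P xs → P (nth k xs)
nth-All zero    _         (p ∷ ps) = p
nth-All (suc k) (s≤s k<n) (p ∷ ps) = nth-All k k<n ps

-- In an increasing list the smaller entries are those in front; they are the unthrown balls passed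
-- by a first throw.
below-sorted : ∀ k us → k < length us → AllPairs _<_ us → below (nth k us) (delete k us) ≡ k
below-sorted zero    (u ∷ us) _         (u< ∷ _)      = below-All u<
below-sorted (suc k) (u ∷ us) (s≤s k<n) (u< ∷ sorted) with u <? nth k us
... | yes _ = cong suc (below-sorted k us k<n sorted)
... | no u≮ = ⊥-elim (u≮ (nth-All k k<n u<))

-- The balance of one pair when `x` is thrown over `t`: the new need plus twice the waste is the old
-- need plus the one crossing made, with a common 1 cancelled.
comparisons : ∀ {x t} → t ≢ x → indicator (x <? t) + 2 * indicator (t ≤? x) ≡ suc (indicator (t <? x))
comparisons {x} {t} t≢x with x <? t | t ≤? x | t <? x
... | yes x<t | yes t≤x | _       = ⊥-elim (<⇒≱ x<t t≤x)
... | yes x<t | no _    | yes t<x = ⊥-elim (<-asym x<t t<x)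
... | yes _   | no _    | no _    = refl
... | no _    | yes _   | yes _   = refl
... | no _    | yes t≤x | no t≮x  = ⊥-elim (t≮x (≤∧≢⇒< t≤x t≢x))
... | no x≮t  | no t≰x  | _       = ⊥-elim (x≮t (≰⇒> t≰x))

-- Throwing a ball to place `k` passes `k` thrown balls. The induction settles the pair formed with
-- the first of them by `comparisons`; all pairs without the moved ball keep their need.
returns-rethrow : ∀ k ts → k < length ts → Unique ts →
  returns (nth k ts ∷ delete k ts) + 2 * atMost (nth k ts) (take k ts) ≡ returns ts + k
returns-rethrow zero    (t ∷ ts) _         _              = refl
returns-rethrow (suc k) (t ∷ ts) (s≤s k<n) (t∉ts ∷ uniq) = begin
  (suc l + (i + ax) + (l + at + r)) + 2 * (m + e)
    ≡⟨ gather l i ax at r m e ⟩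
  (i + 2 * m) + (suc l + at + ((l + ax + r) + 2 * e))
    ≡⟨ cong₂ _+_ (comparisons (nth-All k k<n t∉ts)) (cong (suc l + at +_) (returns-rethrow k ts k<n uniq)) ⟩
  suc j + (suc l + at + (returns ts + k))
    ≡⟨ scatter j l at (returns ts) k ⟩
  (suc l + (j + at) + returns ts) + suc k
    ≡⟨ cong₂ (λ n a → (n + a + returns ts) + suc k) (length-delete k ts k<n) (sym (above-delete t k ts k<n)) ⟩
  (length ts + above t ts + returns ts) + suc k ∎
  where
  x = nth k ts
  l = length (delete k ts)
  i = indicator (x <? t)
  j = indicator (t <? x)
  m = indicator (t ≤? x)
  e = atMost x (take k ts)
  ax = above x (delete k ts)
  at = above t (delete k ts)
  r = returns (delete k ts)
  gather : ∀ l i ax at r m e → (suc l + (i + ax) + (l + at + r)) + 2 * (m + e)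
    ≡ (i + 2 * m) + (suc l + at + ((l + ax + r) + 2 * e))
  gather = solve-∀
  scatter : ∀ j l at r k → suc j + (suc l + at + (r + k)) ≡ (suc l + (j + at) + r) + suc k
  scatter = solve-∀

AllPairs-++ˡ : ∀ {R : ℕ → ℕ → Set} ts {us} → AllPairs R (ts ++ us) → AllPairs R ts
AllPairs-++ˡ []       _        = []
AllPairs-++ˡ (t ∷ ts) (p ∷ ps) = All.++⁻ˡ ts p ∷ AllPairs-++ˡ ts ps

AllPairs-++ʳ : ∀ {R : ℕ → ℕ → Set} ts {us} → AllPairs R (ts ++ us) → AllPairs R us
AllPairs-++ʳ []       ps       = ps
AllPairs-++ʳ (t ∷ ts) (_ ∷ ps) = AllPairs-++ʳ ts ps

AllPairs-cross : ∀ {R : ℕ → ℕ → Set} {ts us t u} → AllPairs R (ts ++ us) → t ∈ ts → u ∈ us → R t u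
AllPairs-cross {ts = t ∷ ts} (p ∷ _)  (here refl) u∈ = All.lookup (All.++⁻ʳ ts p) u∈
AllPairs-cross               (_ ∷ ps) (there t∈)  u∈ = AllPairs-cross ps t∈ u∈

-- The card makes `k` crossings, one with each ball passed, and the need of each such pair changes
-- by one, upwards unless the crossing is wasted.
potential-step : ∀ k ts us → k < length (ts ++ us) → Unique (ts ++ us) → AllPairs _<_ us →
  potential (step k (ts , us)) + 2 * excess k (ts , us) ≡ k + potential (ts , us)
potential-step k ts us k<n uniq sorted with k <? length ts
... | yes k<l = begin
  returns (nth k ts ∷ delete k ts) + overtaken (nth k ts ∷ delete k ts) us + 2 * e
    ≡⟨ cong (λ z → returns (nth k ts ∷ delete k ts) + z + 2 * e) (overtaken-rethrow k ts us k<l) ⟩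
  returns (nth k ts ∷ delete k ts) + o + 2 * e
    ≡⟨ exchange (returns (nth k ts ∷ delete k ts)) o (2 * e) ⟩
  (returns (nth k ts ∷ delete k ts) + 2 * e) + o
    ≡⟨ cong (_+ o) (returns-rethrow k ts k<l (AllPairs-++ˡ ts uniq)) ⟩
  (returns ts + k) + o
    ≡⟨ rotate (returns ts) k o ⟩
  k + (returns ts + o) ∎
  where
  e = atMost (nth k ts) (take k ts)
  o = overtaken ts us
  exchange : ∀ a b c → a + b + c ≡ (a + c) + b
  exchange = solve-∀
  rotate : ∀ a b c → (a + b) + c ≡ b + (a + c)
  rotate = solve-∀
-- A first throw passes all `l` thrown balls and the `j` smaller unthrown ones; the pairs counted by
-- `above x ts` needed one crossing before and now need two.
... | no k≮l = begin
  (l + above x ts + returns ts) + (below x (delete j us) + overtaken ts (delete j us)) + 0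
    ≡⟨ cong (λ z → (l + above x ts + returns ts) + (z + overtaken ts (delete j us)) + 0) (below-sorted j us j<n sorted) ⟩
  (l + above x ts + returns ts) + (j + overtaken ts (delete j us)) + 0
    ≡⟨ gather l (above x ts) (returns ts) j _ ⟩
  (l + j) + (returns ts + (above x ts + overtaken ts (delete j us)))
    ≡⟨ cong₂ _+_ l+j≡k (cong (returns ts +_) (sym (overtaken-delete j ts us j<n))) ⟩
  k + (returns ts + overtaken ts us) ∎
  where
  l = length ts
  j = k ∸ l
  x = nth j us
  l+j≡k : l + j ≡ k
  l+j≡k = m+[n∸m]≡n (≮⇒≥ k≮l)
  j<n : j < length us
  j<n = +-cancelˡ-< l j (length us) (subst₂ _<_ (sym l+j≡k) (length-++ ts) k<n)
  gather : ∀ l a r j o → (l + a + r) + (j + o) + 0 ≡ (l + j) + (r + (a + o))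
  gather = solve-∀

-- Telescopes `potential-step` from the empty suffix, where no ball is thrown and the potential is
-- 0.
crossings : ∀ {b} (cs : List (Card b)) → potential (state cs) + 2 * waste cs ≡ Cr cs
crossings []       = refl
crossings (c ∷ cs) = begin
  potential (step (toℕ c) (state cs)) + 2 * (waste cs + excess (toℕ c) (state cs))
    ≡⟨ gather (potential (step (toℕ c) (state cs))) (waste cs) _ ⟩
  (potential (step (toℕ c) (state cs)) + 2 * excess (toℕ c) (state cs)) + 2 * waste cs
    ≡⟨ cong (_+ 2 * waste cs) (potential-step (toℕ c) (thrown cs) (unthrown cs)
         (subst (toℕ c <_) (sym (arrangement-length cs)) (toℕ<n c)) (arrangement-unique cs) (unthrown-sorted cs)) ⟩
  toℕ c + potential (state cs) + 2 * waste cs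
    ≡⟨ +-assoc (toℕ c) _ _ ⟩
  toℕ c + (potential (state cs) + 2 * waste cs)
    ≡⟨ cong (toℕ c +_) (crossings cs) ⟩
  toℕ c + Cr cs ∎
  where
  gather : ∀ p w e → p + 2 * (w + e) ≡ (p + 2 * e) + 2 * w
  gather = solve-∀

above-sorted : ∀ {t ts} → All (t <_) ts → above t ts ≡ length ts
above-sorted []                          = refl
above-sorted {t} {y ∷ ts} (t<y ∷ t<ts) with t <? y
... | yes _  = cong suc (above-sorted t<ts)
... | no t≮y = ⊥-elim (t≮y t<y)

-- Every pair of an increasing list needs two crossings.
returns-sorted : ∀ {ts} → AllPairs _<_ ts → returns ts ≡ length ts * (length ts ∸ 1)
returns-sorted {[]}         []             = refl
returns-sorted {t ∷ []}     (_ ∷ _)        = refl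
returns-sorted {t ∷ u ∷ ts} (t< ∷ sorted) = begin
  suc l + above t (u ∷ ts) + returns (u ∷ ts)  ≡⟨ cong₂ (λ a r → suc l + a + r) (above-sorted t<) (returns-sorted sorted) ⟩
  suc l + suc l + suc l * l                    ≡⟨ square l ⟩
  suc (suc l) * suc l                          ∎
  where
  l = length ts
  square : ∀ l → suc l + suc l + suc l * l ≡ suc (suc l) * suc l
  square = solve-∀

overtaken-[] : ∀ ts → overtaken ts [] ≡ 0
overtaken-[] []       = refl
overtaken-[] (_ ∷ ts) = overtaken-[] ts

-- Arrangements and the induced permutation

nth-applyUpTo : ∀ e {j n} → j < n → nth j (applyUpTo e n) ≡ e j
nth-applyUpTo e {zero}  (s≤s _)   = refl
nth-applyUpTo e {suc j} (s≤s j<n) = nth-applyUpTo (λ i → e (suc i)) j<n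

nth-ext : ∀ xs ys → length xs ≡ length ys → (∀ j → j < length xs → nth j xs ≡ nth j ys) → xs ≡ ys
nth-ext []       []       _ _ = refl
nth-ext (x ∷ xs) (y ∷ ys) l e =
  cong₂ _∷_ (e 0 z<s) (nth-ext xs ys (suc-injective l) (λ j j<n → e (suc j) (s<s j<n)))

nth-delete-< : ∀ j k xs → j < k → k < length xs → nth j (delete k xs) ≡ nth j xs
nth-delete-< zero    (suc k) (x ∷ xs) _         _         = refl
nth-delete-< (suc j) (suc k) (x ∷ xs) (s≤s j<k) (s≤s k<n) = nth-delete-< j k xs j<k k<n

nth-delete-≥ : ∀ j k xs → k ≤ j → nth j (delete k xs) ≡ nth (suc j) xs
nth-delete-≥ j       k       []       _         = refl
nth-delete-≥ j       zero    (x ∷ xs) _         = refl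
nth-delete-≥ (suc j) (suc k) (x ∷ xs) (s≤s k≤j) = nth-delete-≥ j k xs k≤j

-- Identifies the action of a card on levels with moving an entry to the front: `i` is the position
-- just after the card of the ball at position `j` just before it.
πC-nth : ∀ j k xs → j < length xs → k < length xs →
  ∃[ i ] i < length xs × πC (suc k) (suc j) ≡ suc i × nth j (nth k xs ∷ delete k xs) ≡ nth i xs
πC-nth zero    k xs _   k<n = k , k<n , refl , refl
πC-nth (suc j) k xs j<n k<n with suc (suc j) ≤? suc k
... | yes (s≤s j<k) = j , ≤-trans (n≤1+n _) j<n , refl , nth-delete-< j k xs j<k k<n
... | no j≮k        = suc j , j<n , refl , nth-delete-≥ j k xs (≤-pred (≤-pred (≰⇒> j≮k)))

-- Levels are numbered from 0 in arrangements but from 1 in πSeq.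
πSeq-nth : ∀ {b} (cs : List (Card b)) j → j < b → πSeq cs (suc j) ≡ suc (nth j (arrangement (state cs)))
πSeq-nth         []       j j<b = cong suc (sym (nth-applyUpTo (λ i → i) j<b))
πSeq-nth {b} (c ∷ cs) j j<b
  with πC-nth j (toℕ c) (arrangement (state cs))
         (subst (j <_) (sym (arrangement-length cs)) j<b)
         (subst (toℕ c <_) (sym (arrangement-length cs)) (toℕ<n c))
... | i , i<n , πC≡ , nth≡ = begin
  πSeq cs (πC (suc (toℕ c)) (suc j))      ≡⟨ cong (πSeq cs) πC≡ ⟩
  πSeq cs (suc i)                         ≡⟨ πSeq-nth cs i (subst (i <_) (arrangement-length cs) i<n) ⟩
  suc (nth i (arrangement (state cs)))    ≡⟨ cong suc (sym nth≡) ⟩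
  suc (nth j (nth (toℕ c) (arrangement (state cs)) ∷ delete (toℕ c) (arrangement (state cs))))
    ≡⟨ cong (λ xs → suc (nth j xs)) (sym (arrangement-step (toℕ c) (state cs))) ⟩
  suc (nth j (arrangement (state (c ∷ cs)))) ∎

isId⇒arrangement : ∀ {b} (cs : List (Card b)) → IsId cs → arrangement (state cs) ≡ upTo b
isId⇒arrangement {b} cs isId =
  nth-ext _ _ (trans (arrangement-length cs) (sym (length-upTo b))) λ j j<n →
    let j<b = subst (j <_) (arrangement-length cs) j<n in
    trans (suc-injective (trans (sym (πSeq-nth cs j j<b)) (All.lookup (All.map⁻ isId) (∈-upTo⁺ j<b))))
          (sym (nth-applyUpTo (λ i → i) j<b))

arrangement⇒isId : ∀ {b} (cs : List (Card b)) → arrangement (state cs) ≡ upTo b → IsId cs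
arrangement⇒isId {b} cs eq = All.map⁺ (All.tabulate λ {j} j∈ →
  trans (πSeq-nth cs j (∈-upTo⁻ j∈))
        (cong suc (trans (cong (nth j) eq) (nth-applyUpTo (λ i → i) (∈-upTo⁻ j∈)))))

-- Throws of the top ball

delete-∷ʳ : ∀ j vs (x : ℕ) → j < length vs → delete j (vs ∷ʳ x) ≡ delete j vs ∷ʳ x
delete-∷ʳ j vs x = delete-++ˡ j vs (x ∷ [])

-- Until it is thrown, the ball `m` stays last among the unthrown balls, hence at position `m` of
-- the arrangement, and only the top card reaches that position.
top-thrown : ∀ {m} (cs : List (Card (suc m))) →
  (m ∈ thrown cs × UsesTop cs) ⊎ (¬ UsesTop cs × ∃[ vs ] unthrown cs ≡ vs ∷ʳ m)
top-thrown {m} [] = inj₂ ((λ ()) , upTo m , sym (upTo-∷ʳ m))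
top-thrown {m} (c ∷ cs) with top-thrown cs
... | inj₁ (m∈ , uses) with toℕ c <? length (thrown cs)
...   | yes k<l = inj₁ (∈-resp-↭ (↭.↭-sym (nth-delete-↭ (toℕ c) (thrown cs) k<l)) m∈ , there uses)
...   | no _    = inj₁ (there m∈ , there uses)
top-thrown {m} (c ∷ cs) | inj₂ (unused , vs , eq) = result
  where
  l = length (thrown cs)
  m≡ : l + length vs ≡ m
  m≡ = suc-injective (trans (sym (+-suc l (length vs))) (begin
    l + suc (length vs)                ≡⟨ cong (l +_) (sym (length-∷ʳ vs)) ⟩
    l + length (vs ∷ʳ m)               ≡⟨ cong (λ us → l + length us) (sym eq) ⟩
    l + length (unthrown cs)           ≡⟨ sym (length-++ (thrown cs)) ⟩
    length (arrangement (state cs))    ≡⟨ arrangement-length cs ⟩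
    suc m                              ∎))
    where
    length-∷ʳ : ∀ vs → length (vs ∷ʳ m) ≡ suc (length vs)
    length-∷ʳ vs = trans (length-++ vs) (+-comm (length vs) 1)
  stillUnused : toℕ c < m → ¬ UsesTop (c ∷ cs)
  stillUnused k<m (here k≡m)   = <-irrefl (suc-injective k≡m) k<m
  stillUnused k<m (there uses) = unused uses
  result : (m ∈ thrown (c ∷ cs) × UsesTop (c ∷ cs)) ⊎ (¬ UsesTop (c ∷ cs) × ∃[ vs ] unthrown (c ∷ cs) ≡ vs ∷ʳ m)
  result with toℕ c <? l
  ... | yes k<l = inj₂ (stillUnused (subst (toℕ c <_) m≡ (≤-trans k<l (m≤m+n l (length vs)))) , vs , eq)
  ... | no k≮l with toℕ c ∸ l <? length vs
  ...   | yes j<n = inj₂ (stillUnused (subst₂ _<_ l+j≡k m≡ (+-monoʳ-< l j<n))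
                         , delete (toℕ c ∸ l) vs , trans (cong (delete (toℕ c ∸ l)) eq) (delete-∷ʳ (toℕ c ∸ l) vs m j<n))
    where
    l+j≡k : l + (toℕ c ∸ l) ≡ toℕ c
    l+j≡k = m+[n∸m]≡n (≮⇒≥ k≮l)
  -- The position is at least `m`, and the card index bounds it by `m`, so this is the top card.
  ...   | no j≮n  = inj₁ (here (sym (begin
            nth (toℕ c ∸ l) (unthrown cs)  ≡⟨ cong₂ nth j≡n eq ⟩
            nth (length vs) (vs ∷ʳ m)      ≡⟨ nth-++ʳ (length vs) vs (m ∷ []) ≤-refl ⟩
            nth (length vs ∸ length vs) (m ∷ []) ≡⟨ cong (λ i → nth i (m ∷ [])) (n∸n≡0 (length vs)) ⟩
            m ∎))
          , here (cong suc k≡m))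
    where
    l+j≡k : l + (toℕ c ∸ l) ≡ toℕ c
    l+j≡k = m+[n∸m]≡n (≮⇒≥ k≮l)
    k≡m : toℕ c ≡ m
    k≡m = ≤-antisym (≤-pred (toℕ<n c)) (subst₂ _≤_ m≡ l+j≡k (+-monoʳ-≤ l (≮⇒≥ j≮n)))
    j≡n : toℕ c ∸ l ≡ length vs
    j≡n = +-cancelˡ-≡ l _ _ (trans l+j≡k (trans k≡m (sym m≡)))

-- Minimal sequences as waste-free sequences

potential-upTo : ∀ b → potential (upTo b , []) ≡ b * (b ∸ 1)
potential-upTo b = begin
  returns (upTo b) + overtaken (upTo b) []     ≡⟨ cong₂ _+_ (returns-sorted (AllPairs.applyUpTo⁺₁ (λ i → i) b (λ i<j _ → i<j))) (overtaken-[] (upTo b)) ⟩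
  length (upTo b) * (length (upTo b) ∸ 1) + 0  ≡⟨ +-identityʳ _ ⟩
  length (upTo b) * (length (upTo b) ∸ 1)      ≡⟨ cong (λ l → l * (l ∸ 1)) (length-upTo b) ⟩
  b * (b ∸ 1)                                  ∎

++-[]-≡ : ∀ (xs : List ℕ) {ys} → length (xs ++ ys) ≡ length xs → ys ≡ []
++-[]-≡ xs {[]}     _ = refl
++-[]-≡ xs {y ∷ ys} e = ⊥-elim (m+1+n≢m (length xs) (trans (sym (length-++ xs)) e))

minimal⇒ : ∀ {m} (cs : List (Card (suc m))) → MinimalCrossing cs → thrown cs ≡ upTo (suc m) × waste cs ≡ 0
minimal⇒ {m} cs (uses , isId , cr) with top-thrown cs
... | inj₂ (unused , _) = ⊥-elim (unused uses)
... | inj₁ (m∈ , _)     = thrown≡ , waste≡0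
  where
  arranged : arrangement (state cs) ≡ upTo (suc m)
  arranged = isId⇒arrangement cs isId
  sorted : AllPairs _<_ (arrangement (state cs))
  sorted = subst (AllPairs _<_) (sym arranged) (AllPairs.applyUpTo⁺₁ (λ i → i) (suc m) (λ i<j _ → i<j))
  bounded : All (_≤ m) (unthrown cs)
  bounded = All.map ≤-pred (All.++⁻ʳ (thrown cs) (subst (All (_< suc m)) (sym arranged) (All.all-upTo (suc m))))
  unthrown≡[] : unthrown cs ≡ []
  unthrown≡[] with unthrown cs | sorted | bounded
  ... | []    | _ | _       = refl
  -- The thrown ball `m` precedes `u` in an increasing arrangement, so `u` would exceed `m`.
  ... | u ∷ _ | s | u≤m ∷ _ = ⊥-elim (<⇒≱ (AllPairs-cross {ts = thrown cs} s m∈ (here refl)) u≤m)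
  thrown≡ : thrown cs ≡ upTo (suc m)
  thrown≡ = trans (sym (++-identityʳ (thrown cs)))
              (trans (cong (thrown cs ++_) (sym unthrown≡[])) arranged)
  waste≡0 : waste cs ≡ 0
  -- The potential of the final state already equals the prescribed number of crossings.
  waste≡0 = m+n≡0⇒m≡0 (waste cs) (+-cancelˡ-≡ (suc m * m) _ _ (begin
    suc m * m + 2 * waste cs                ≡⟨ cong (_+ 2 * waste cs) (sym (potential-upTo (suc m))) ⟩
    potential (upTo (suc m) , []) + 2 * waste cs ≡⟨ cong₂ (λ ts us → potential (ts , us) + 2 * waste cs) (sym thrown≡) (sym unthrown≡[]) ⟩
    potential (state cs) + 2 * waste cs     ≡⟨ crossings cs ⟩
    Cr cs                                   ≡⟨ cr ⟩
    suc m * m                               ≡⟨ sym (+-identityʳ _) ⟩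
    suc m * m + 0                           ∎))

minimal⇐ : ∀ {m} (cs : List (Card (suc m))) → thrown cs ≡ upTo (suc m) → waste cs ≡ 0 → MinimalCrossing cs
minimal⇐ {m} cs thrown≡ waste≡0 = usesTop , arrangement⇒isId cs arranged , cr
  where
  unthrown≡[] : unthrown cs ≡ []
  unthrown≡[] = ++-[]-≡ (thrown cs) (trans (arrangement-length cs)
    (sym (trans (cong length thrown≡) (length-upTo (suc m)))))
  arranged : arrangement (state cs) ≡ upTo (suc m)
  arranged = trans (cong₂ _++_ thrown≡ unthrown≡[]) (++-identityʳ (upTo (suc m)))
  usesTop : UsesTop cs
  usesTop with top-thrown cs
  ... | inj₁ (_ , uses)    = uses
  ... | inj₂ (_ , vs , eq) = ⊥-elim (nonempty vs (trans (sym eq) unthrown≡[]))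
    where
    nonempty : ∀ vs → vs ∷ʳ m ≢ []
    nonempty []      ()
    nonempty (_ ∷ _) ()
  cr : Cr cs ≡ suc m * m
  cr = begin
    Cr cs                                        ≡⟨ sym (crossings cs) ⟩
    potential (state cs) + 2 * waste cs          ≡⟨ cong₂ (λ st w → potential st + 2 * w) (cong₂ _,_ thrown≡ unthrown≡[]) waste≡0 ⟩
    potential (upTo (suc m) , []) + 0            ≡⟨ +-identityʳ _ ⟩
    potential (upTo (suc m) , [])                ≡⟨ potential-upTo (suc m) ⟩
    suc m * m                                    ∎

hits : ∀ {b} → List ℕ → List (Card b) → ℕ
hits ts cs = same (thrown cs) ts * isZero (waste cs)

same-refl : ∀ xs → same xs xs ≡ 1
same-refl []       = refl
same-refl (x ∷ xs) with x ≟ x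
... | yes _   = trans (+-identityʳ _) (same-refl xs)
... | no x≢x  = ⊥-elim (x≢x refl)

same-≢ : ∀ xs ys → xs ≢ ys → same xs ys ≡ 0
same-≢ []       []       xs≢ = ⊥-elim (xs≢ refl)
same-≢ []       (_ ∷ _)  xs≢ = refl
same-≢ (_ ∷ _)  []       xs≢ = refl
same-≢ (x ∷ xs) (y ∷ ys) xs≢ with x ≟ y
... | no _     = refl
... | yes refl = trans (+-identityʳ _) (same-≢ xs ys (λ e → xs≢ (cong (x ∷_) e)))

minimal-hits : ∀ {m} (cs : List (Card (suc m))) → indicator (minimalCrossing? cs) ≡ hits (upTo (suc m)) cs
minimal-hits {m} cs with minimalCrossing? cs
... | yes min = let (thrown≡ , waste≡0) = minimal⇒ cs min in
  sym (cong₂ _*_ (trans (cong (λ ts → same ts (upTo (suc m))) thrown≡) (same-refl (upTo (suc m)))) (cong isZero waste≡0))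
... | no ¬min with ≡-dec _≟_ (thrown cs) (upTo (suc m)) | waste cs in eq
...   | no ≢      | _     = sym (cong (_* isZero _) (same-≢ _ _ ≢))
...   | yes _     | suc _ = sym (*-zeroʳ (same (thrown cs) (upTo (suc m))))
...   | yes ≡upTo | zero  = ⊥-elim (¬min (minimal⇐ cs ≡upTo eq))

-- Sums over card sequences

∑ : ∀ {A : Set} → List A → (A → ℕ) → ℕ
∑ xs g = sum (map g xs)

∑-cong : ∀ {A : Set} (xs : List A) {g h} → (∀ x → g x ≡ h x) → ∑ xs g ≡ ∑ xs h
∑-cong []       e = refl
∑-cong (x ∷ xs) e = cong₂ _+_ (e x) (∑-cong xs e)

∑-+ : ∀ {A : Set} (xs : List A) g h → ∑ xs (λ x → g x + h x) ≡ ∑ xs g + ∑ xs h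
∑-+ []       g h = refl
∑-+ (x ∷ xs) g h = trans (cong (g x + h x +_) (∑-+ xs g h)) (+-interchange (g x) (h x) _ _)

∑-* : ∀ {A : Set} (xs : List A) c g → ∑ xs (λ x → c * g x) ≡ c * ∑ xs g
∑-* []       c g = sym (*-zeroʳ c)
∑-* (x ∷ xs) c g = trans (cong (c * g x +_) (∑-* xs c g)) (sym (*-distribˡ-+ c (g x) _))

∑-filter : ∀ {A : Set} {P : A → Set} (P? : ∀ x → Dec (P x)) xs →
  length (filter P? xs) ≡ ∑ xs (λ x → indicator (P? x))
∑-filter P? []       = refl
∑-filter P? (x ∷ xs) with P? x
... | yes _ = cong suc (∑-filter P? xs)
... | no _  = ∑-filter P? xs

∑-concatMap : ∀ {A B : Set} (k : A → List B) xs g → ∑ (concatMap k xs) g ≡ ∑ xs (λ x → ∑ (k x) g)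
∑-concatMap k []       g = refl
∑-concatMap k (x ∷ xs) g = begin
  sum (map g (k x ++ concatMap k xs))              ≡⟨ cong sum (map-++ g (k x) _) ⟩
  sum (map g (k x) ++ map g (concatMap k xs))      ≡⟨ sum-++ (map g (k x)) _ ⟩
  ∑ (k x) g + ∑ (concatMap k xs) g                 ≡⟨ cong (∑ (k x) g +_) (∑-concatMap k xs g) ⟩
  ∑ (k x) g + ∑ xs (λ x → ∑ (k x) g)               ∎

∑-tabulate : ∀ {A : Set} n (e : Fin n → A) (g : A → ℕ) h → (∀ i → g (e i) ≡ h (toℕ i)) →
  ∑ (tabulate e) g ≡ sumBelow n h
∑-tabulate zero    e g h eq = refl
∑-tabulate (suc n) e g h eq = cong₂ _+_ (eq Fin.zero)
  (∑-tabulate n (λ i → e (Fin.suc i)) g (λ k → h (suc k)) (λ i → eq (Fin.suc i)))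

∑-sumBelow : ∀ {A : Set} (xs : List A) n (h : ℕ → A → ℕ) →
  sumBelow n (λ k → ∑ xs (h k)) ≡ ∑ xs (λ x → sumBelow n (λ k → h k x))
∑-sumBelow xs zero    h = sym (∑-* xs 0 (λ _ → 0))
∑-sumBelow xs (suc n) h = trans (cong (∑ xs (h 0) +_) (∑-sumBelow xs n (λ k → h (suc k)))) (sym (∑-+ xs _ _))

∑-insertions : ∀ {A B : Set} (xs : List B) (w : A → ℕ) a (g : List A → B → ℕ) ts →
  ∑ xs (λ x → insertions w a (λ s → g s x) ts) ≡ insertions w a (λ s → ∑ xs (g s)) ts
∑-insertions xs w a g []       = refl
∑-insertions xs w a g (t ∷ ts) = trans (∑-+ xs _ _) (cong (∑ xs (g (a ∷ t ∷ ts)) +_)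
  (trans (∑-* xs (w t) _) (cong (w t *_) (∑-insertions xs w a (λ s → g (t ∷ s)) ts))))

-- Recurrence for waste-free sequences

count : ∀ b → ℕ → List ℕ → ℕ
count b n ts = ∑ (sequences b n) (hits ts)

f-count : ∀ n m → f n (suc m) ≡ count (suc m) n (upTo (suc m))
f-count n m = trans (∑-filter minimalCrossing? (sequences (suc m) n)) (∑-cong (sequences (suc m) n) minimal-hits)

-- Moves the sum over the first card inside, so that it is evaluated for a fixed suffix and its
-- state.
∑-sequences : ∀ b n (g : List (Card b) → ℕ) (h : ℕ → List (Card b) → ℕ) → (∀ c cs → g (c ∷ cs) ≡ h (toℕ c) cs) →
  ∑ (sequences b (suc n)) g ≡ ∑ (sequences b n) (λ cs → sumBelow b (λ k → h k cs))
∑-sequences b n g h eq = begin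
  ∑ (concatMap (λ c → map (c ∷_) (sequences b n)) (allFin b)) g
    ≡⟨ ∑-concatMap (λ c → map (c ∷_) (sequences b n)) (allFin b) g ⟩
  ∑ (allFin b) (λ c → ∑ (map (c ∷_) (sequences b n)) g)
    ≡⟨ ∑-tabulate b (λ i → i) _ (λ k → ∑ (sequences b n) (h k))
         (λ c → trans (cong sum (sym (map-∘ (sequences b n)))) (∑-cong (sequences b n) (eq c))) ⟩
  sumBelow b (λ k → ∑ (sequences b n) (h k))
    ≡⟨ ∑-sumBelow (sequences b n) b h ⟩
  ∑ (sequences b n) (λ cs → sumBelow b (λ k → h k cs)) ∎

reached : ℕ → List ℕ → State → ℕ
reached k ts st = same (proj₁ (step k st)) ts * isZero (excess k st)

reached-old : ∀ k ts us ts′ → k < length ts →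
  reached k ts′ (ts , us) ≡ same (nth k ts ∷ delete k ts) ts′ * isZero (atMost (nth k ts) (take k ts))
reached-old k ts us ts′ k<l with k <? length ts
... | yes _  = refl
... | no k≮l = ⊥-elim (k≮l k<l)

reached-new : ∀ j ts us ts′ → reached (length ts + j) ts′ (ts , us) ≡ same (nth j us ∷ ts) ts′
reached-new j ts us ts′ with length ts + j <? length ts
... | yes l+j<l = ⊥-elim (<⇒≱ l+j<l (m≤m+n (length ts) j))
... | no _      = trans (*-identityʳ _) (cong (λ i → same (nth i us ∷ ts) ts′) (m+n∸m≡n (length ts) j))

-- The cards below `length ts` are rethrows and give the insertions. The others are first throws;
-- exactly one of them throws `x` if `ts` is `ts′`, and otherwise none reaches the target.
reached-count : ∀ x ts us ts′ → Unique (ts ++ us) → x ∈ ts ++ us → x ∉ ts′ →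
  sumBelow (length (ts ++ us)) (λ k → reached k (x ∷ ts′) (ts , us))
  ≡ same ts ts′ + insertions (Above x) x (same ts) ts′
reached-count x ts us ts′ uniq x∈ x∉ts′ = begin
  sumBelow (length (ts ++ us)) r
    ≡⟨ cong (λ l → sumBelow l r) (length-++ ts) ⟩
  sumBelow (length ts + length us) r
    ≡⟨ sumBelow-+ (length ts) (length us) r ⟩
  sumBelow (length ts) r + sumBelow (length us) (λ j → r (length ts + j))
    ≡⟨ cong₂ _+_ (trans (sumBelow-cong (length ts) (λ k k<l → reached-old k ts us (x ∷ ts′) k<l)) (rethrow-count x ts ts′))
         (trans (sumBelow-cong (length us) (λ j _ → trans (reached-new j ts us (x ∷ ts′)) (*-comm _ (same ts ts′)))) (trans (sumBelow-* (length us) (same ts ts′) _) new)) ⟩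
  insertions (Above x) x (same ts) ts′ + same ts ts′
    ≡⟨ +-comm (insertions (Above x) x (same ts) ts′) _ ⟩
  same ts ts′ + insertions (Above x) x (same ts) ts′ ∎
  where
  r : ℕ → ℕ
  r k = reached k (x ∷ ts′) (ts , us)
  new : same ts ts′ * sumBelow (length us) (λ j → indicator (nth j us ≟ x)) ≡ same ts ts′
  new with ≡-dec _≟_ ts ts′
  ... | no ≢ rewrite same-≢ ts ts′ ≢ = refl
  -- The list `ts` now omits `x`, so `x` is unthrown and occurs there exactly once.
  ... | yes refl with ∈-++⁻ ts x∈
  ...   | inj₁ x∈ts = ⊥-elim (x∉ts′ x∈ts)
  ...   | inj₂ x∈us = trans (cong (same ts ts *_) (occurs-1 (AllPairs-++ʳ ts uniq) x∈us)) (*-identityʳ _)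

-- Waste is additive, so its vanishing factors into a condition on the suffix and one on the first
-- card; `reached-count` sums the latter over that card.
count-suc : ∀ b n x ts → x < b → x ∉ ts →
  count b (suc n) (x ∷ ts) ≡ count b n ts + insertions (Above x) x (count b n) ts
count-suc b n x ts x<b x∉ts = begin
  count b (suc n) (x ∷ ts)
    ≡⟨ ∑-sequences b n (hits (x ∷ ts)) (λ k cs → isZero (waste cs) * reached k (x ∷ ts) (state cs)) (λ c cs →
         trans (cong (same (thrown (c ∷ cs)) (x ∷ ts) *_) (isZero-+ (waste cs) _)) (*-swapˡ (same (thrown (c ∷ cs)) (x ∷ ts)) (isZero (waste cs)) _)) ⟩
  ∑ (sequences b n) (λ cs → sumBelow b (λ k → isZero (waste cs) * reached k (x ∷ ts) (state cs)))
    ≡⟨ ∑-cong (sequences b n) pointwise ⟩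
  ∑ (sequences b n) (λ cs → hits ts cs + insertions (Above x) x (λ s → hits s cs) ts)
    ≡⟨ ∑-+ (sequences b n) _ _ ⟩
  count b n ts + ∑ (sequences b n) (λ cs → insertions (Above x) x (λ s → hits s cs) ts)
    ≡⟨ cong (count b n ts +_) (∑-insertions (sequences b n) (Above x) x hits ts) ⟩
  count b n ts + insertions (Above x) x (count b n) ts ∎
  where
  insertions-hits : ∀ (cs : List (Card b)) ts →
    isZero (waste cs) * insertions (Above x) x (same (thrown cs)) ts ≡ insertions (Above x) x (λ s → hits s cs) ts
  insertions-hits cs ts = trans (sym (insertions-* (Above x) x (isZero (waste cs)) _ ts))
    (insertions-cong (λ s → *-comm (isZero (waste cs)) (same (thrown cs) s)) ts)
    where
    insertions-cong : ∀ {g h : List ℕ → ℕ} → (∀ s → g s ≡ h s) → ∀ ts → insertions (Above x) x g ts ≡ insertions (Above x) x h ts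
    insertions-cong e []       = e _
    insertions-cong e (t ∷ ts) = cong₂ _+_ (e _) (cong (Above x t *_) (insertions-cong (λ s → e (t ∷ s)) ts))
  pointwise : ∀ cs → sumBelow b (λ k → isZero (waste cs) * reached k (x ∷ ts) (state cs))
    ≡ hits ts cs + insertions (Above x) x (λ s → hits s cs) ts
  pointwise cs = begin
    sumBelow b (λ k → isZero (waste cs) * reached k (x ∷ ts) (state cs))
      ≡⟨ sumBelow-* b (isZero (waste cs)) _ ⟩
    isZero (waste cs) * sumBelow b (λ k → reached k (x ∷ ts) (state cs))
      ≡⟨ cong (λ l → isZero (waste cs) * sumBelow l (λ k → reached k (x ∷ ts) (state cs))) (sym (arrangement-length cs)) ⟩
    isZero (waste cs) * sumBelow (length (arrangement (state cs))) (λ k → reached k (x ∷ ts) (state cs))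
      ≡⟨ cong (isZero (waste cs) *_) (reached-count x (thrown cs) (unthrown cs) ts (arrangement-unique cs)
           (∈-resp-↭ (↭.↭-sym (arrangement-↭ cs)) (∈-upTo⁺ x<b)) x∉ts) ⟩
    isZero (waste cs) * (same (thrown cs) ts + insertions (Above x) x (same (thrown cs)) ts)
      ≡⟨ *-distribˡ-+ (isZero (waste cs)) _ _ ⟩
    isZero (waste cs) * same (thrown cs) ts + isZero (waste cs) * insertions (Above x) x (same (thrown cs)) ts
      ≡⟨ cong₂ _+_ (*-comm (isZero (waste cs)) _) (insertions-hits cs ts) ⟩
    hits ts cs + insertions (Above x) x (λ s → hits s cs) ts ∎

count-[] : ∀ b n → count b (suc n) [] ≡ 0
count-[] b n = trans
  (∑-sequences b n (hits []) (λ _ _ → 0) (λ c cs → cong (_* isZero (waste (c ∷ cs))) (nonempty (toℕ c) (state cs))))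
  (trans (∑-cong (sequences b n) (λ _ → sumBelow-* b 0 (λ _ → 0))) (∑-* (sequences b n) 0 (λ _ → 0)))
  where
  nonempty : ∀ k st → same (proj₁ (step k st)) [] ≡ 0
  nonempty k (ts , us) with k <? length ts
  ... | yes _ = refl
  ... | no _  = refl

-- From card sequences to patterns

-- The next live entry must lie below `lo` and the next fresh one must be at least `hi`. The bounds
-- move past each entry read, which makes live entries decrease and fresh ones increase; for
-- `lo ≤ hi` all live entries are below all fresh ones.
data Pattern : ℕ → ℕ → List Status → List ℕ → Set where
  []    : ∀ {lo hi} → Pattern lo hi [] []
  fresh : ∀ {lo hi t s ts} → hi ≤ t → Pattern lo (suc t) s ts → Pattern lo hi (fresh ∷ s) (t ∷ ts)
  live  : ∀ {lo hi t s ts} → t < lo → Pattern t hi s ts → Pattern lo hi (live ∷ s) (t ∷ ts)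

Pattern-weaken : ∀ {lo lo′ hi hi′ s ts} → lo ≤ lo′ → hi′ ≤ hi → Pattern lo hi s ts → Pattern lo′ hi′ s ts
Pattern-weaken l h []           = []
Pattern-weaken l h (fresh hi≤ p) = fresh (≤-trans h hi≤) (Pattern-weaken l ≤-refl p)
Pattern-weaken l h (live <lo p) = live (<-≤-trans <lo l) (Pattern-weaken ≤-refl h p)

Pattern-∉ : ∀ {lo hi s ts x} → lo ≤ x → x < hi → Pattern lo hi s ts → x ∉ ts
Pattern-∉ lo≤x x<hi (fresh hi≤x _) (here refl) = <⇒≱ x<hi hi≤x
Pattern-∉ lo≤x x<hi (fresh hi≤t p) (there x∈)  = Pattern-∉ lo≤x (m≤n⇒m≤1+n (<-≤-trans x<hi hi≤t)) p x∈
Pattern-∉ lo≤x x<hi (live x<lo _)  (here refl) = <⇒≱ x<lo lo≤x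
Pattern-∉ lo≤x x<hi (live t<lo p)  (there x∈)  = Pattern-∉ (≤-trans (<⇒≤ t<lo) lo≤x) x<hi p x∈

Above-< : ∀ {x t} → x < t → Above x t ≡ 1
Above-< {x} {t} x<t with x <? t
... | yes _  = refl
... | no x≮t = ⊥-elim (x≮t x<t)

Above-≮ : ∀ {x t} → ¬ x < t → Above x t ≡ 0
Above-≮ {x} {t} x≮t with x <? t
... | yes x<t = ⊥-elim (x≮t x<t)
... | no _    = refl

-- The fresh entries exceed `x` and the live ones are below it, so the weights `Above x` and
-- `isFresh` agree. The inserted `x` becomes the first and largest live entry, whence the bound
-- `suc x`.
insertions-Pattern : ∀ {P : ℕ → Set} {x hi s ts g h} → P x → x < hi → Pattern x hi s ts → All P ts →
  (∀ {s ts} → Pattern (suc x) hi s ts → All P ts → g ts ≡ h s) →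
  insertions (Above x) x g ts ≡ insertions isFresh live h s
insertions-Pattern px x<hi []                []         e = e (live ≤-refl []) (px ∷ [])
insertions-Pattern px x<hi p@(fresh hi≤t p′) (pt ∷ pts) e = cong₂ _+_
  (e (live ≤-refl p) (px ∷ pt ∷ pts))
  (cong₂ _*_ (Above-< (<-≤-trans x<hi hi≤t))
    (insertions-Pattern px (m≤n⇒m≤1+n (<-≤-trans x<hi hi≤t)) p′ pts
      (λ q pq → e (fresh hi≤t q) (pt ∷ pq))))
-- Insertion stops at the first live entry, where both weights are 0.
insertions-Pattern {x = x} {ts = t ∷ ts} {g} px x<hi p@(live t<x _) (pt ∷ pts) e = cong₂ _+_
  (e (live ≤-refl p) (px ∷ pt ∷ pts))
  (cong (_* insertions (Above x) x (λ s → g (t ∷ s)) ts) (Above-≮ (<-asym t<x)))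

-- Both kinds of first entry leave a tail to which x can be restored as the
-- largest live ball, so they contribute equally.
Pattern-tail : ∀ {lo hi σ s x ts} → lo ≤ hi → Pattern lo hi (σ ∷ s) (x ∷ ts) → Pattern x (suc x) s ts
Pattern-tail lo≤hi (fresh hi≤x p) = Pattern-weaken (≤-trans lo≤hi hi≤x) ≤-refl p
Pattern-tail lo≤hi (live x<lo p)  = Pattern-weaken ≤-refl (≤-trans x<lo lo≤hi) p

-- Both sides satisfy the same recurrence: the tail has a pattern with bounds `x` and `suc x`, so it
-- omits `x` and accepts it back as its largest live ball.
count-throws : ∀ b n {lo hi s ts} → lo ≤ hi → Pattern lo hi s ts → All (_< b) ts → count b n ts ≡ throws s n
count-throws b zero    _     []          _            = refl
count-throws b zero    _     (fresh _ _) _            = refl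
count-throws b zero    _     (live _ _)  _            = refl
count-throws b (suc n) _     []          _            = count-[] b n
count-throws b (suc n) {s = σ ∷ s} {x ∷ ts} lo≤hi p (x<b ∷ ts<b) = begin
  count b (suc n) (x ∷ ts)
    ≡⟨ count-suc b n x ts x<b (Pattern-∉ ≤-refl ≤-refl tail) ⟩
  count b n ts + insertions (Above x) x (count b n) ts
    ≡⟨ cong₂ _+_ (count-throws b n (n≤1+n x) tail ts<b)
         (insertions-Pattern x<b ≤-refl tail ts<b (count-throws b n ≤-refl)) ⟩
  throws s n + insertions isFresh live (λ r → throws r n) s ∎
  where
  tail = Pattern-tail lo≤hi p

Pattern-applyUpTo : ∀ e n {lo hi} → hi ≤ e 0 → (∀ i → e i < e (suc i)) →
  Pattern lo hi (replicate n fresh) (applyUpTo e n)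
Pattern-applyUpTo e zero    hi≤ inc = []
Pattern-applyUpTo e (suc n) hi≤ inc =
  fresh hi≤ (Pattern-applyUpTo (λ i → e (suc i)) n (inc 0) (λ i → inc (suc i)))

f-total : ∀ n m → f n (suc m) ≡ total n (suc m) 0
f-total n m = begin
  f n (suc m)                             ≡⟨ f-count n m ⟩
  count (suc m) n (upTo (suc m))
    -- Before any card is undone every ball is fresh.
    ≡⟨ count-throws (suc m) n {0} {0} z≤n (Pattern-applyUpTo (λ i → i) (suc m) z≤n (λ _ → ≤-refl)) (All.all-upTo (suc m)) ⟩
  throws (replicate (suc m) fresh) n      ≡⟨ sym (interleavings-replicate (suc m) (λ s → throws s n)) ⟩
  total n (suc m) 0                       ∎

theorem4p2 : (n b : ℕ) → 1 ≤ n → 1 ≤ b →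
    (b * f n b ≡ ((n ∸ 1) C (b ∸ 1)) * (n C (b ∸ 1)))
    × (n * f n b ≡ (n C b) * (n C (b ∸ 1)))
theorem4p2 (suc n) (suc a) _ _ = narayana n a (f (suc n) (suc a)) (begin
  f (suc n) (suc a) + (suc (suc n) C suc a) * (n C suc a)
    ≡⟨ cong₂ (λ t k → t + (suc (suc n) C suc a) * (n C k)) (f-total (suc n) a) (sym (+-identityʳ (suc a))) ⟩
  total (suc n) (suc a) 0 + (suc (suc n) C suc a) * (n C (suc a + 0))
    ≡⟨ total-closed n (suc a) 0 ⟩
  (suc n C suc a) * (suc n C (suc a + 0))
    ≡⟨ cong (λ k → (suc n C suc a) * (suc n C k)) (+-identityʳ (suc a)) ⟩
  (suc n C suc a) * (suc n C suc a) ∎)
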